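{- Let $d\ge 1$ and $k\ge 0$ be integers and put $n=d+k+1$. For every $T\in L_{n,d}$ with $T\neq\hat 0$ (i.e. $T$ is not the empty family), \[ \mu_{n,d}(T)=\prod_{T_i\in T}\mu_{\,n-|T_i|,\;d-|T_i|}(\hat 1)=\prod_{T_i\in T}\mu_{\,k+\operatorname{codim}_d(T_i),\;\operatorname{codim}_d(T_i)-1}(\hat 1). \]
   Context: For integers $n\ge 1$, $d\ge 0$: for a finite set $X$ put $\operatorname{codim}_d(X)=d+1-|X|$. For a family $T=\{T_1,\dots,T_l\}$ of distinct finite sets put $\rho_d(T)=\sum_i\operatorname{codim}_d(T_i)$ (with $\rho_d(\emptyset)=0$) and $D_d(T)=\operatorname{codim}_d(T_1\cap\dots\cap T_l)-\rho_d(T)$. Let $L_{n,d}$ be the set of families $T\subset 2^{\{1,\dots,n\}}$ such that $0\le|T_i|\le d$ for all $T_i\in T$ and $D_d(T')>0$ for every subfamily $T'\subset T$ with $|T'|>1$. Order $L_{n,d}$ by: $T<T'$ iff $\rho_d(T)<\rho_d(T')$ and for every $T_i\in T$ there is $T'_j\in T'$ with $T'_j\subset T_i$. (This poset is isomorphic to the intersection lattice, including the empty intersection, of the arrangement of all affine hyperplanes spanned by $d$-subsets of $n$ generic points in a $d$-dimensional space.) Its minimum $\hat 0$ is the empty family and its maximum $\hat 1$ is $\{\emptyset\}$; for $d=0$ the poset $L_{n,0}$ is $\{\hat0,\hat1\}$. $\mu_{n,d}(T)$ denotes the Möbius function value $\mu(\hat 0,T)$ of $L_{n,d}$, and $\mu_{n,d}(\hat1)=\mu(\hat0,\hat1)$.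 -}

module Defs where

open import Data.Bool using (Bool; true; false; _∧_; if_then_else_; T?)
open import Data.Nat using (ℕ; zero; suc; _∸_)
open import Data.Integer using (ℤ; +_; _-_; _*_; -_; _<?_; 0ℤ; 1ℤ; _+_) renaming (∣_∣ to absℤ)
open import Data.List using (List; []; _∷_; map; foldr; length; filter; _++_; null)
open import Data.List.Relation.Unary.All using () renaming (all? to allL?)
open import Data.List.Relation.Unary.Any using (any?)
open import Data.Fin.Subset using (Subset; ∣_∣; ⋂; _⊆_; ⊥; inside; outside)
open import Data.Fin.Subset.Properties using (_⊆?_)
open import Data.Vec using ([]; _∷_)
import Data.Nat as N
open import Relation.Nullary.Decidable using (⌊_⌋; does; _→-dec_)
open import Relation.Binary.PropositionalEquality using (_≡_)

allSubsets : (n : ℕ) → List (Subset n)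
allSubsets zero = [] ∷ []
allSubsets (suc n) = map (outside ∷_) (allSubsets n) ++ map (inside ∷_) (allSubsets n)

sublists : {A : Set} → List A → List (List A)
sublists [] = [] ∷ []
sublists (x ∷ xs) = sublists xs ++ map (x ∷_) (sublists xs)

-- A family of subsets of {1..n}: a list of subsets.  The families of
-- distinct subsets are enumerated (each once, in canonical order) by
Family : ℕ → Set
Family n = List (Subset n)

families : (n : ℕ) → List (Family n)
families n = sublists (allSubsets n)

codim : {n : ℕ} → ℕ → Subset n → ℤ
codim d X = + suc d - + Data.Fin.Subset.∣ X ∣

sumℤ : List ℤ → ℤ
sumℤ = foldr _+_ 0ℤ

prodℤ : List ℤ → ℤ
prodℤ = foldr _*_ 1ℤ

ρ : {n : ℕ} → ℕ → Family n → ℤ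
ρ d T = sumℤ (map (codim d) T)

D : {n : ℕ} → ℕ → Family n → ℤ
D d T = codim d (⋂ T) - ρ d T

inL : {n : ℕ} → ℕ → Family n → Bool
inL d T =
  ⌊ allL? (λ X → Data.Fin.Subset.∣ X ∣ N.≤? d) T ⌋
  ∧ ⌊ allL? (λ T' → (1 N.<? length T') →-dec (0ℤ <? D d T')) (sublists T) ⌋

L : (n d : ℕ) → List (Family n)
L n d = filter (λ T → T? (inL d T)) (families n)

lt : {n : ℕ} → ℕ → Family n → Family n → Bool
lt d T T' = ⌊ ρ d T <? ρ d T' ⌋ ∧ ⌊ allL? (λ Ti → any? (λ Tj → Tj ⊆? Ti) T') T ⌋

-- Möbius function μ(0̂, T) of L_{n,d}, by the standard recursion
--   μ(0̂,0̂) = 1,   μ(0̂,T) = - Σ_{S ∈ L_{n,d}, S < T} μ(0̂,S),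
-- computed with a fuel argument (fuel |ρ_d(T)| + 1 suffices for T ∈ L_{n,d},
-- since ρ_d is ≥ 0 on L_{n,d} and strictly increasing along <).
mobiusFuel : (n d : ℕ) → ℕ → Family n → ℤ
mobiusFuel n d zero T = 0ℤ
mobiusFuel n d (suc f) T =
  if null T then 1ℤ
  else - sumℤ (map (mobiusFuel n d f) (filter (λ S → T? (lt d S T)) (L n d)))

μ : (n d : ℕ) → Family n → ℤ
μ n d T = mobiusFuel n d (suc (absℤ (ρ d T))) T

top : (n : ℕ) → Family n
top n = ⊥ ∷ []

μ̂1 : (n d : ℕ) → ℤ
μ̂1 n d = μ n d (top n)

{-# OPTIONS --safe #-}

-- Write F(S) = ∏ μ(0̂, {X}) over the members X of S.  If T = {X} ∪ R with R nonempty, every S ≤ T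
-- splits uniquely into its members containing X and the rest, and every such pair of families in L
-- recombines to an element of L, so Σ_{S ≤ T} F(S) has the factor Σ_{S ≤ {X}} F(S).  By induction on
-- the rank this factor is Σ_{S ≤ {X}} μ(0̂, S) = 0, hence F satisfies the recursion defining μ and
-- μ(0̂, T) = F(T).  Deleting X from all members identifies the interval [0̂, {X}] of L_{n,d} with
-- L_{n-|X|, d-|X|}, its top {X} with {∅}.
module Submission where

open import Defs
open import Algebra.Core using (Op₂)
open import Algebra.Structures using (IsCommutativeMonoid)
open import Data.Bool using (true; false; if_then_else_; _∧_; T; T?)
import Data.Fin as Fin
open import Data.Fin.Subset using (Subset; ∣_∣; ⋂; _∩_; _⊆_; _∉_; ⊤; ⊥; ∁; inside; outside)
open import Data.Fin.Subset.Properties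
  using (_⊆?_; ⊆-refl; ⊆⊤; out⊆; out⊆-⇔; s⊆s; in⊆in-⇔; drop-∷-⊆; p⊆q⇒∣p∣≤∣q∣; ∣∁p∣≡n∸∣p∣; x∈p∩q⁺;
         ∩-assoc; ∩-comm; ∩-identityʳ; ∩-isCommutativeMonoid)
open import Data.Integer using (ℤ; +_; -_; _-_; _*_; 0ℤ; 1ℤ) renaming (∣_∣ to absℤ)
import Data.Integer as ℤ
import Data.Integer.Properties as ℤ
open import Data.Integer.Tactic.RingSolver using (solve-∀)
open import Data.List using (List; []; _∷_; map; filter; _++_; length)
open import Data.List.Membership.Propositional using (_∈_; find)
open import Data.List.Membership.Propositional.Properties
  using (∈-++⁺ˡ; ∈-++⁺ʳ; ∈-++⁻; ∈-map⁺; ∈-map⁻; ∈-filter⁻)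
open import Data.List.Properties
  using (map-++; map-∘; map-cong; map-cong-local; filter-++; filter-none; length-map)
open import Data.List.Relation.Binary.Permutation.Propositional using (_↭_; ↭-refl; ↭-sym; ↭-trans; ↭-prep)
open import Data.List.Relation.Binary.Permutation.Propositional.Properties using (∈-resp-↭; shift)
open import Data.List.Relation.Binary.Sublist.Propositional
  using ([]; _∷_; _∷ʳ_; minimum)
  renaming (_⊆_ to _⊑_; lookup to ⊑-lookup; ⊆-refl to ⊑-refl; ⊆-trans to ⊑-trans)
open import Data.List.Relation.Binary.Sublist.Propositional.Properties using (filter-⊆; filter⁺; All-resp-⊆)
open import Data.List.Relation.Unary.All using (All; []; _∷_)
import Data.List.Relation.Unary.All as All
import Data.List.Relation.Unary.All.Properties as All
open import Data.List.Relation.Unary.AllPairs using ([]; _∷_)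
open import Data.List.Relation.Unary.Any using (Any; here; there)
import Data.List.Relation.Unary.Any as Any
import Data.List.Relation.Unary.Any.Properties as Any
open import Data.List.Relation.Unary.Unique.Propositional using (Unique)
import Data.List.Relation.Unary.Unique.Propositional.Properties as Unique
open import Data.Nat using (ℕ; zero; suc; _+_; _∸_; _≤_; _<_; z≤n; s≤s)
import Data.Nat as ℕ
import Data.Nat.Properties as ℕ
open import Data.Product using (_×_; _,_; proj₁; proj₂; ∃-syntax)
import Data.Product as Product
open import Data.Sum using (_⊎_; inj₁; inj₂)
open import Data.Vec using ([]; _∷_)
import Data.Vec as Vec
open import Function using (_∘_; id; case_of_)
open import Function.Bundles using (_⇔_; mk⇔; module Equivalence)
open import Level using (0ℓ)
open import Relation.Binary.PropositionalEquality
  using (_≡_; _≢_; refl; sym; trans; cong; cong₂; subst; subst₂; module ≡-Reasoning)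
open import Relation.Nullary using (Dec; does; yes; no; ¬_; contradiction)
open import Relation.Nullary.Decidable using (dec-true; dec-false; ⌊_⌋; _×-dec_; _→-dec_)
open import Relation.Unary using (Pred; Decidable)
open import Relation.Unary.Properties using (∁?)

open Equivalence using (to; from)

-- The delicate point is that recombined pairs stay in `L`. A subfamily with members on both sides
-- of the split is controlled by neither side alone, so its `D` is compared with that of a subfamily
-- of T: its members over X are merged into X, the others into members of R. Replacing a set by a
-- smaller one raises the codimension of the whole intersection by at most what it raises the
-- codimension of that set, so merging cannot increase `D`. At least two members of T remain
-- afterwards, and there `D` is positive. The rank condition in < concerns a family as a whole and
-- does not split along X. The factorization is therefore done for refinement alone; a rank
-- comparison then shows that refinement within `L` is strict except for equality, so this sum
-- differs from the one in the recursion by its diagonal term only.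

private
  variable
    A B P Q : Set
    n : ℕ

-- Sums over sublists

∑ : List A → (A → ℤ) → ℤ
∑ xs f = sumℤ (map f xs)

-- Membership in `L` and the order relation become weights 0 or 1, so that every sum runs over all
-- sublists of one fixed list.
when : Dec P → ℤ → ℤ
when P? z = if does P? then z else 0ℤ

when-true : (P? : Dec P) {z : ℤ} → P → when P? z ≡ z
when-true P? p rewrite dec-true P? p = refl

when-false : (P? : Dec P) {z : ℤ} → ¬ P → when P? z ≡ 0ℤ
when-false P? ¬p rewrite dec-false P? ¬p = refl

-- The values are compared only under the condition `P`; this is where induction hypotheses with
-- side conditions enter.
when-cong : (P? : Dec P) (Q? : Dec Q) {y z : ℤ} →
            (P → Q) → (Q → P) → (P → y ≡ z) → when P? y ≡ when Q? z
when-cong (yes p) Q? to from eq = trans (eq p) (sym (when-true Q? (to p)))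
when-cong (no ¬p) Q? to from eq = sym (when-false Q? (¬p ∘ from))

when-when : (P? : Dec P) (Q? : Dec Q) (z : ℤ) → when P? (when Q? z) ≡ when (P? ×-dec Q?) z
when-when (yes _) (yes _) z = refl
when-when (yes _) (no _)  z = refl
when-when (no _)  _       z = refl

when-*-when : (P? : Dec P) (Q? : Dec Q) (y z : ℤ) →
              when P? y * when Q? z ≡ when (P? ×-dec Q?) (y * z)
when-*-when (yes _) (yes _) y z = refl
when-*-when (yes _) (no _)  y z = ℤ.*-zeroʳ y
when-*-when (no _)  _       y z = refl

∑-cong-∈ : {f g : A → ℤ} (xs : List A) → (∀ x → x ∈ xs → f x ≡ g x) → ∑ xs f ≡ ∑ xs g
∑-cong-∈ []       eq = refl
∑-cong-∈ (x ∷ xs) eq = cong₂ ℤ._+_ (eq x (here refl)) (∑-cong-∈ xs (λ y → eq y ∘ there))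

∑-cong : {f g : A → ℤ} (xs : List A) → (∀ x → f x ≡ g x) → ∑ xs f ≡ ∑ xs g
∑-cong xs eq = ∑-cong-∈ xs (λ x _ → eq x)

∑-zero : {f : A → ℤ} (xs : List A) → (∀ x → f x ≡ 0ℤ) → ∑ xs f ≡ 0ℤ
∑-zero []       eq = refl
∑-zero (x ∷ xs) eq = cong₂ ℤ._+_ (eq x) (∑-zero xs eq)

∑-++ : (f : A → ℤ) (xs ys : List A) → ∑ (xs ++ ys) f ≡ ∑ xs f ℤ.+ ∑ ys f
∑-++ f []       ys = sym (ℤ.+-identityˡ _)
∑-++ f (x ∷ xs) ys = trans (cong (ℤ._+_ (f x)) (∑-++ f xs ys)) (sym (ℤ.+-assoc (f x) _ _))

∑-map : (g : A → B) (f : B → ℤ) (xs : List A) → ∑ (map g xs) f ≡ ∑ xs (f ∘ g)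
∑-map g f xs = cong sumℤ (sym (map-∘ xs))

∑-filter : {P : Pred A 0ℓ} (P? : Decidable P) (f : A → ℤ) (xs : List A) →
           ∑ (filter P? xs) f ≡ ∑ xs (λ x → when (P? x) (f x))
∑-filter P? f []       = refl
∑-filter P? f (x ∷ xs) with does (P? x)
... | true  = cong (ℤ._+_ (f x)) (∑-filter P? f xs)
... | false = trans (∑-filter P? f xs) (sym (ℤ.+-identityˡ _))

-- Isolates a diagonal term: it is applied with `f` weighted by ≤ and `g` by <, which differ at `a`
-- alone.
∑-except : {f g : A → ℤ} {a : A} {xs : List A} → Unique xs → a ∈ xs →
           (∀ x → x ∈ xs → x ≢ a → f x ≡ g x) → g a ≡ 0ℤ → ∑ xs f ≡ ∑ xs g ℤ.+ f a
∑-except {f = f} {g} {a} {.a ∷ xs} (a∉ ∷ _) (here refl) eq ga = begin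
  f a ℤ.+ ∑ xs f          ≡⟨ cong (ℤ._+_ (f a)) (∑-cong-∈ xs
                               λ x x∈ → eq x (there x∈) λ { refl → All.lookup a∉ x∈ refl }) ⟩
  f a ℤ.+ ∑ xs g          ≡⟨ ℤ.+-comm (f a) _ ⟩
  ∑ xs g ℤ.+ f a          ≡⟨ cong (λ z → z ℤ.+ f a) (sym (ℤ.+-identityˡ (∑ xs g))) ⟩
  0ℤ ℤ.+ ∑ xs g ℤ.+ f a     ≡⟨ cong (λ z → z ℤ.+ ∑ xs g ℤ.+ f a) (sym ga) ⟩
  g a ℤ.+ ∑ xs g ℤ.+ f a    ∎
  where open ≡-Reasoning
∑-except {f = f} {g} {a} {y ∷ xs} (y∉ ∷ u) (there a∈) eq ga = begin
  f y ℤ.+ ∑ xs f          ≡⟨ cong₂ ℤ._+_ (eq y (here refl) (All.lookup y∉ a∈))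
                                      (∑-except u a∈ (λ x → eq x ∘ there) ga) ⟩
  g y ℤ.+ (∑ xs g ℤ.+ f a)  ≡⟨ sym (ℤ.+-assoc (g y) _ _) ⟩
  g y ℤ.+ ∑ xs g ℤ.+ f a    ∎
  where open ≡-Reasoning

∑-sublists-∷ : (f : List A → ℤ) (x : A) (xs : List A) →
               ∑ (sublists (x ∷ xs)) f ≡ ∑ (sublists xs) f ℤ.+ ∑ (sublists xs) (f ∘ (x ∷_))
∑-sublists-∷ f x xs =
  trans (∑-++ f (sublists xs) _) (cong (ℤ._+_ (∑ (sublists xs) f)) (∑-map (x ∷_) f (sublists xs)))

module _ {P : Pred A 0ℓ} (P? : Decidable P) where

  ∑-sublists-filter : (f : List A → ℤ) (xs : List A) → (∀ S → ¬ All P S → f S ≡ 0ℤ) →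
                      ∑ (sublists xs) f ≡ ∑ (sublists (filter P? xs)) f
  ∑-sublists-filter f []       f≡0 = refl
  ∑-sublists-filter f (x ∷ xs) f≡0 with P? x
  ... | yes p = begin
    ∑ (sublists (x ∷ xs)) f                                 ≡⟨ ∑-sublists-∷ f x xs ⟩
    ∑ (sublists xs) f ℤ.+ ∑ (sublists xs) (f ∘ (x ∷_))        ≡⟨ cong₂ ℤ._+_ (∑-sublists-filter f xs f≡0)
                                                                 (∑-sublists-filter (f ∘ (x ∷_)) xs
                                                                   λ S ¬a → f≡0 (x ∷ S) λ { (_ ∷ a) → ¬a a }) ⟩
    ∑ (sublists ys) f ℤ.+ ∑ (sublists ys) (f ∘ (x ∷_))        ≡⟨ sym (∑-sublists-∷ f x ys) ⟩
    ∑ (sublists (x ∷ ys)) f                                 ∎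
    where
    open ≡-Reasoning
    ys = filter P? xs
  ... | no ¬p = begin
    ∑ (sublists (x ∷ xs)) f                           ≡⟨ ∑-sublists-∷ f x xs ⟩
    ∑ (sublists xs) f ℤ.+ ∑ (sublists xs) (f ∘ (x ∷_))  ≡⟨ cong (ℤ._+_ (∑ (sublists xs) f))
                                                           (∑-zero (sublists xs) λ S → f≡0 (x ∷ S) λ { (p ∷ _) → ¬p p }) ⟩
    ∑ (sublists xs) f ℤ.+ 0ℤ                            ≡⟨ ℤ.+-identityʳ _ ⟩
    ∑ (sublists xs) f                                 ≡⟨ ∑-sublists-filter f xs f≡0 ⟩
    ∑ (sublists (filter P? xs)) f                     ∎
    where open ≡-Reasoning

  -- A sublist amounts to two independent choices, one among the entries in `P` and one among the
  -- others. Each entry of `xs` extends just one of the two factors, and distributivity collects the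
  -- terms with and without it.
  ∑-sublists-* : (f g : List A → ℤ) (xs : List A) →
                 ∑ (sublists xs) (λ S → f (filter P? S) * g (filter (∁? P?) S))
                   ≡ ∑ (sublists (filter P? xs)) f * ∑ (sublists (filter (∁? P?) xs)) g
  ∑-sublists-* f g [] = begin
    f [] * g [] ℤ.+ 0ℤ             ≡⟨ ℤ.+-identityʳ _ ⟩
    f [] * g []                  ≡⟨ sym (cong₂ _*_ (ℤ.+-identityʳ (f [])) (ℤ.+-identityʳ (g []))) ⟩
    (f [] ℤ.+ 0ℤ) * (g [] ℤ.+ 0ℤ)    ∎
    where open ≡-Reasoning
  ∑-sublists-* f g (x ∷ xs) = trans (∑-sublists-∷ _ x xs) (split (P? x) refl)
    where
    open ≡-Reasoning
    ys = filter P? xs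
    zs = filter (∁? P?) xs
    h : List A → ℤ
    h S = f (filter P? S) * g (filter (∁? P?) S)
    split : (p? : Dec (P x)) → P? x ≡ p? →
            ∑ (sublists xs) h ℤ.+ ∑ (sublists xs) (h ∘ (x ∷_))
              ≡ ∑ (sublists (filter P? (x ∷ xs))) f * ∑ (sublists (filter (∁? P?) (x ∷ xs))) g
    split (yes p) eq rewrite eq = begin
      ∑ (sublists xs) h ℤ.+ ∑ (sublists xs) (λ S → f (x ∷ filter P? S) * g (filter (∁? P?) S))
        ≡⟨ cong₂ ℤ._+_ (∑-sublists-* f g xs) (∑-sublists-* (f ∘ (x ∷_)) g xs) ⟩
      ∑ (sublists ys) f * ∑ (sublists zs) g ℤ.+ ∑ (sublists ys) (f ∘ (x ∷_)) * ∑ (sublists zs) g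
        ≡⟨ sym (ℤ.*-distribʳ-+ (∑ (sublists zs) g) (∑ (sublists ys) f) _) ⟩
      (∑ (sublists ys) f ℤ.+ ∑ (sublists ys) (f ∘ (x ∷_))) * ∑ (sublists zs) g
        ≡⟨ cong (_* ∑ (sublists zs) g) (sym (∑-sublists-∷ f x ys)) ⟩
      ∑ (sublists (x ∷ ys)) f * ∑ (sublists zs) g ∎
    split (no ¬p) eq rewrite eq = begin
      ∑ (sublists xs) h ℤ.+ ∑ (sublists xs) (λ S → f (filter P? S) * g (x ∷ filter (∁? P?) S))
        ≡⟨ cong₂ ℤ._+_ (∑-sublists-* f g xs) (∑-sublists-* f (g ∘ (x ∷_)) xs) ⟩
      ∑ (sublists ys) f * ∑ (sublists zs) g ℤ.+ ∑ (sublists ys) f * ∑ (sublists zs) (g ∘ (x ∷_))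
        ≡⟨ sym (ℤ.*-distribˡ-+ (∑ (sublists ys) f) (∑ (sublists zs) g) _) ⟩
      ∑ (sublists ys) f * (∑ (sublists zs) g ℤ.+ ∑ (sublists zs) (g ∘ (x ∷_)))
        ≡⟨ cong (∑ (sublists ys) f *_) (sym (∑-sublists-∷ g x zs)) ⟩
      ∑ (sublists ys) f * ∑ (sublists (x ∷ zs)) g ∎

-- Sublists as canonical representatives of families

∈-sublists⁺ : {S xs : List A} → S ⊑ xs → S ∈ sublists xs
∈-sublists⁺ []         = here refl
∈-sublists⁺ (x ∷ʳ S⊑)  = ∈-++⁺ˡ (∈-sublists⁺ S⊑)
∈-sublists⁺ {xs = x ∷ xs} (refl ∷ S⊑) = ∈-++⁺ʳ (sublists xs) (∈-map⁺ (x ∷_) (∈-sublists⁺ S⊑))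

∈-sublists⁻ : {S : List A} (xs : List A) → S ∈ sublists xs → S ⊑ xs
∈-sublists⁻ []       (here refl) = []
∈-sublists⁻ (x ∷ xs) S∈ with ∈-++⁻ (sublists xs) S∈
... | inj₁ S∈ˡ = x ∷ʳ ∈-sublists⁻ xs S∈ˡ
... | inj₂ S∈ʳ with ∈-map⁻ (x ∷_) S∈ʳ
...   | S′ , S′∈ , refl = refl ∷ ∈-sublists⁻ xs S′∈

sublists-map : (f : A → B) (xs : List A) → sublists (map f xs) ≡ map (map f) (sublists xs)
sublists-map f []       = refl
sublists-map f (x ∷ xs) = begin
  sublists (map f xs) ++ map (f x ∷_) (sublists (map f xs))
    ≡⟨ cong (λ Ss → Ss ++ map (f x ∷_) Ss) (sublists-map f xs) ⟩
  map (map f) (sublists xs) ++ map (f x ∷_) (map (map f) (sublists xs))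
    ≡⟨ cong (map (map f) (sublists xs) ++_) (trans (sym (map-∘ (sublists xs))) (map-∘ (sublists xs))) ⟩
  map (map f) (sublists xs) ++ map (map f) (map (x ∷_) (sublists xs))
    ≡⟨ sym (map-++ (map f) (sublists xs) _) ⟩
  map (map f) (sublists xs ++ map (x ∷_) (sublists xs)) ∎
  where open ≡-Reasoning

sublists-unique : {xs : List A} → Unique xs → Unique (sublists xs)
sublists-unique []       = [] ∷ []
sublists-unique {xs = x ∷ xs} (x∉ ∷ u) =
  Unique.++⁺ (sublists-unique u) (Unique.map⁺ (λ { refl → refl }) (sublists-unique u)) disjoint
  where
  disjoint : ∀ {S} → ¬ (S ∈ sublists xs × S ∈ map (x ∷_) (sublists xs))
  disjoint (S∈ , S∈′) with ∈-map⁻ (x ∷_) S∈′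
  ... | _ , _ , refl = All.lookup x∉ (⊑-lookup (∈-sublists⁻ xs S∈) (here refl)) refl

-- When the ambient list has no duplicates, membership alone decides at each entry whether a sublist
-- keeps it. Hence families that are equal as sets are equal as lists in `families`.
⊑-↭⇒≡ : {S S′ xs : List A} → Unique xs → S ⊑ xs → S′ ⊑ xs → S ↭ S′ → S ≡ S′
⊑-↭⇒≡ u S⊑ S′⊑ S↭S′ = go u S⊑ S′⊑ (∈-resp-↭ S↭S′) (∈-resp-↭ (↭-sym S↭S′))
  where
  go : {S S′ xs : List A} → Unique xs → S ⊑ xs → S′ ⊑ xs →
       (∀ {a} → a ∈ S → a ∈ S′) → (∀ {a} → a ∈ S′ → a ∈ S) → S ≡ S′
  go [] [] [] _ _ = refl
  go (x∉ ∷ u) (x ∷ʳ p)   (.x ∷ʳ q)  to from = go u p q to from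
  go (x∉ ∷ u) (x ∷ʳ p)   (refl ∷ q) to from =
    contradiction refl (All.lookup x∉ (⊑-lookup p (from (here refl))))
  go (x∉ ∷ u) (refl ∷ p) (x ∷ʳ q)   to from =
    contradiction refl (All.lookup x∉ (⊑-lookup q (to (here refl))))
  go (x∉ ∷ u) (_∷_ {x} refl p) (refl ∷ q) to from =
    cong (x ∷_) (go u p q (λ a∈ → strip (⊑-lookup p a∈) (to (there a∈)))
                          (λ a∈ → strip (⊑-lookup q a∈) (from (there a∈))))
    where
    strip : ∀ {a ys} → a ∈ _ → a ∈ x ∷ ys → a ∈ ys
    strip a∈xs (here refl) = contradiction refl (All.lookup x∉ a∈xs)
    strip a∈xs (there a∈)  = a∈

-- The interval below {X}

Refines : Family n → Family n → Set
Refines S S′ = All (λ X → Any (_⊆ X) S′) S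

True-∧ : {P Q : Set} (P? : Dec P) (Q? : Dec Q) → T (⌊ P? ⌋ ∧ ⌊ Q? ⌋) ⇔ (P × Q)
True-∧ (yes p) (yes q) = mk⇔ (λ _ → p , q) _
True-∧ (yes p) (no ¬q) = mk⇔ (λ ()) (λ (_ , q) → ¬q q)
True-∧ (no ¬p) Q?      = mk⇔ (λ ()) (λ (p , _) → ¬p p)

inL-⇔ : (d : ℕ) (S : Family n) → T (inL d S) ⇔
        (All (λ X → ∣ X ∣ ≤ d) S × All (λ S′ → 1 < length S′ → 0ℤ ℤ.< D d S′) (sublists S))
inL-⇔ d S = True-∧ (All.all? (λ X → ∣ X ∣ ℕ.≤? d) S)
                   (All.all? (λ S′ → (1 ℕ.<? length S′) →-dec (0ℤ ℤ.<? D d S′)) (sublists S))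

lt-⇔ : (d : ℕ) (S S′ : Family n) → T (lt d S S′) ⇔ (ρ d S ℤ.< ρ d S′ × Refines S S′)
lt-⇔ d S S′ = True-∧ (ρ d S ℤ.<? ρ d S′) (All.all? (λ X → Any.any? (λ Y → Y ⊆? X) S′) S)

-- The order isomorphism from subsets of the complement of X to supersets of X.
adjoin : (X : Subset n) → Subset ∣ ∁ X ∣ → Subset n
adjoin []            Y       = []
adjoin (inside  ∷ X) Y       = inside ∷ adjoin X Y
adjoin (outside ∷ X) (y ∷ Y) = y ∷ adjoin X Y

∣adjoin∣ : (X : Subset n) (Y : Subset ∣ ∁ X ∣) → ∣ adjoin X Y ∣ ≡ ∣ X ∣ + ∣ Y ∣
∣adjoin∣ []            []            = refl
∣adjoin∣ (inside  ∷ X) Y             = cong suc (∣adjoin∣ X Y)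
∣adjoin∣ (outside ∷ X) (inside  ∷ Y) = trans (cong suc (∣adjoin∣ X Y)) (sym (ℕ.+-suc ∣ X ∣ ∣ Y ∣))
∣adjoin∣ (outside ∷ X) (outside ∷ Y) = ∣adjoin∣ X Y

adjoin-⊥ : (X : Subset n) → adjoin X ⊥ ≡ X
adjoin-⊥ []            = refl
adjoin-⊥ (inside  ∷ X) = cong (inside ∷_) (adjoin-⊥ X)
adjoin-⊥ (outside ∷ X) = cong (outside ∷_) (adjoin-⊥ X)

adjoin-⊤ : (X : Subset n) → adjoin X ⊤ ≡ ⊤
adjoin-⊤ []            = refl
adjoin-⊤ (inside  ∷ X) = cong (inside ∷_) (adjoin-⊤ X)
adjoin-⊤ (outside ∷ X) = cong (inside ∷_) (adjoin-⊤ X)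

adjoin-∩ : (X : Subset n) (Y Z : Subset ∣ ∁ X ∣) → adjoin X (Y ∩ Z) ≡ adjoin X Y ∩ adjoin X Z
adjoin-∩ []            Y       Z       = refl
adjoin-∩ (inside  ∷ X) Y       Z       = cong (inside ∷_) (adjoin-∩ X Y Z)
adjoin-∩ (outside ∷ X) (y ∷ Y) (z ∷ Z) = cong (_ ∷_) (adjoin-∩ X Y Z)

adjoin-⋂ : (X : Subset n) (S : Family ∣ ∁ X ∣) → adjoin X (⋂ S) ≡ ⋂ (map (adjoin X) S)
adjoin-⋂ X []      = adjoin-⊤ X
adjoin-⋂ X (Y ∷ S) = trans (adjoin-∩ X Y (⋂ S)) (cong (adjoin X Y ∩_) (adjoin-⋂ X S))

⊆-adjoin : (X : Subset n) (Y : Subset ∣ ∁ X ∣) → X ⊆ adjoin X Y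
⊆-adjoin []            Y       = id
⊆-adjoin (inside  ∷ X) Y       = s⊆s (⊆-adjoin X Y)
⊆-adjoin (outside ∷ X) (y ∷ Y) = out⊆ (⊆-adjoin X Y)

adjoin-mono-⊆ : (X : Subset n) {Y Z : Subset ∣ ∁ X ∣} → Y ⊆ Z → adjoin X Y ⊆ adjoin X Z
adjoin-mono-⊆ []            Y⊆Z = id
adjoin-mono-⊆ (inside  ∷ X) Y⊆Z = s⊆s (adjoin-mono-⊆ X Y⊆Z)
adjoin-mono-⊆ (outside ∷ X) {outside ∷ Y} {z ∷ Z} Y⊆Z = out⊆ (adjoin-mono-⊆ X (drop-∷-⊆ Y⊆Z))
adjoin-mono-⊆ (outside ∷ X) {inside ∷ Y} {z ∷ Z} Y⊆Z with Y⊆Z Vec.here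
... | Vec.here = s⊆s (adjoin-mono-⊆ X (drop-∷-⊆ Y⊆Z))

adjoin-cancel-⊆ : (X : Subset n) {Y Z : Subset ∣ ∁ X ∣} → adjoin X Y ⊆ adjoin X Z → Y ⊆ Z
adjoin-cancel-⊆ []            {[]} {[]} Y⊆Z = id
adjoin-cancel-⊆ (inside  ∷ X) Y⊆Z = adjoin-cancel-⊆ X (drop-∷-⊆ Y⊆Z)
adjoin-cancel-⊆ (outside ∷ X) {outside ∷ Y} {z ∷ Z} Y⊆Z = out⊆ (adjoin-cancel-⊆ X (drop-∷-⊆ Y⊆Z))
adjoin-cancel-⊆ (outside ∷ X) {inside ∷ Y} {z ∷ Z} Y⊆Z with Y⊆Z Vec.here
... | Vec.here = s⊆s (adjoin-cancel-⊆ X (drop-∷-⊆ Y⊆Z))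

filter-map : {A B : Set} {P : Pred B 0ℓ} {Q : Pred A 0ℓ} (P? : Decidable P) (Q? : Decidable Q) (f : A → B) →
             (∀ x → Q x ⇔ P (f x)) → (xs : List A) → filter P? (map f xs) ≡ map f (filter Q? xs)
filter-map P? Q? f Q⇔P []       = refl
filter-map P? Q? f Q⇔P (x ∷ xs) with P? (f x) | Q? x
... | yes _ | yes _ = cong (f x ∷_) (filter-map P? Q? f Q⇔P xs)
... | no _  | no _  = filter-map P? Q? f Q⇔P xs
... | yes p | no ¬q = contradiction (from (Q⇔P x) p) ¬q
... | no ¬p | yes q = contradiction (to (Q⇔P x) q) ¬p

-- `adjoin X` respects the order of enumeration, so the lists agree entry by entry and sums over
-- families carry over without any permutation.
filter-⊇-allSubsets : (X : Subset n) → filter (X ⊆?_) (allSubsets n) ≡ map (adjoin X) (allSubsets ∣ ∁ X ∣)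
filter-⊇-allSubsets []                     = refl
filter-⊇-allSubsets {suc n} (inside ∷ X) = begin
  filter (inside ∷ X ⊆?_) (map (outside ∷_) (allSubsets n) ++ map (inside ∷_) (allSubsets n))
    ≡⟨ filter-++ (inside ∷ X ⊆?_) (map (outside ∷_) (allSubsets n)) _ ⟩
  filter (inside ∷ X ⊆?_) (map (outside ∷_) (allSubsets n)) ++
  filter (inside ∷ X ⊆?_) (map (inside ∷_) (allSubsets n))
    ≡⟨ cong₂ _++_ (filter-none (inside ∷ X ⊆?_)
                    (All.map⁺ (All.universal (λ Y X⊆ → in⊈out Y (X⊆ Vec.here)) (allSubsets n))))
                  (filter-map _ (X ⊆?_) (inside ∷_) (λ _ → in⊆in-⇔) (allSubsets n)) ⟩
  map (inside ∷_) (filter (X ⊆?_) (allSubsets n))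
    ≡⟨ cong (map (inside ∷_)) (filter-⊇-allSubsets X) ⟩
  map (inside ∷_) (map (adjoin X) (allSubsets ∣ ∁ X ∣))
    ≡⟨ sym (map-∘ (allSubsets ∣ ∁ X ∣)) ⟩
  map (adjoin (inside ∷ X)) (allSubsets ∣ ∁ X ∣) ∎
  where
  open ≡-Reasoning
  in⊈out : (Y : Subset n) → Fin.zero ∉ outside ∷ Y
  in⊈out Y ()
filter-⊇-allSubsets {suc n} (outside ∷ X) = begin
  filter (outside ∷ X ⊆?_) (map (outside ∷_) (allSubsets n) ++ map (inside ∷_) (allSubsets n))
    ≡⟨ filter-++ (outside ∷ X ⊆?_) (map (outside ∷_) (allSubsets n)) _ ⟩
  filter (outside ∷ X ⊆?_) (map (outside ∷_) (allSubsets n)) ++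
  filter (outside ∷ X ⊆?_) (map (inside ∷_) (allSubsets n))
    ≡⟨ cong₂ _++_ (half outside) (half inside) ⟩
  map (adjoin (outside ∷ X)) (map (outside ∷_) (allSubsets ∣ ∁ X ∣)) ++
  map (adjoin (outside ∷ X)) (map (inside ∷_) (allSubsets ∣ ∁ X ∣))
    ≡⟨ sym (map-++ (adjoin (outside ∷ X)) (map (outside ∷_) (allSubsets ∣ ∁ X ∣)) _) ⟩
  map (adjoin (outside ∷ X)) (allSubsets (suc ∣ ∁ X ∣)) ∎
  where
  open ≡-Reasoning
  half : ∀ s → filter (outside ∷ X ⊆?_) (map (s ∷_) (allSubsets n))
               ≡ map (adjoin (outside ∷ X)) (map (s ∷_) (allSubsets ∣ ∁ X ∣))
  half s = begin
    filter (outside ∷ X ⊆?_) (map (s ∷_) (allSubsets n))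
      ≡⟨ filter-map _ (X ⊆?_) (s ∷_) (λ _ → out⊆-⇔) (allSubsets n) ⟩
    map (s ∷_) (filter (X ⊆?_) (allSubsets n))
      ≡⟨ cong (map (s ∷_)) (filter-⊇-allSubsets X) ⟩
    map (s ∷_) (map (adjoin X) (allSubsets ∣ ∁ X ∣))
      ≡⟨ trans (sym (map-∘ (allSubsets ∣ ∁ X ∣))) (map-∘ (allSubsets ∣ ∁ X ∣)) ⟩
    map (adjoin (outside ∷ X)) (map (s ∷_) (allSubsets ∣ ∁ X ∣)) ∎

-- Both filters move into the summand, which leaves a sum over all sublists of `allSubsets n`, the
-- form required for restricting and factoring.
∑-L-below : (d : ℕ) (T′ : Family n) (f : Family n → ℤ) →
            ∑ (filter (λ S → T? (lt d S T′)) (L n d)) f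
              ≡ ∑ (families n) (λ S → when (T? (inL d S) ×-dec T? (lt d S T′)) (f S))
∑-L-below {n} d T′ f =
  trans (∑-filter (λ S → T? (lt d S T′)) f (L n d)) (
  trans (∑-filter (λ S → T? (inL d S)) (λ S → when (T? (lt d S T′)) (f S)) (families n))
        (∑-cong (families n) λ S → when-when (T? (inL d S)) (T? (lt d S T′)) (f S)))

module _ (d : ℕ) (X : Subset n) (∣X∣≤d : ∣ X ∣ ≤ d) where

  private
    c = ∣ ∁ X ∣
    e = d ∸ ∣ X ∣

  -- The size of the set and the dimension both shift by `∣ X ∣`, and the shifts cancel.
  codim-adjoin : (Y : Subset c) → codim d (adjoin X Y) ≡ codim e Y
  codim-adjoin Y = begin
    + suc d - + ∣ adjoin X Y ∣
      ≡⟨ cong₂ (λ a b → + suc a - + b) (sym (ℕ.m+[n∸m]≡n ∣X∣≤d)) (∣adjoin∣ X Y) ⟩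
    1ℤ ℤ.+ (+ ∣ X ∣ ℤ.+ + e) - (+ ∣ X ∣ ℤ.+ + ∣ Y ∣)
      ≡⟨ cancel (+ ∣ X ∣) (+ e) (+ ∣ Y ∣) ⟩
    1ℤ ℤ.+ + e - + ∣ Y ∣ ∎
    where
    open ≡-Reasoning
    cancel : ∀ x a b → 1ℤ ℤ.+ (x ℤ.+ a) - (x ℤ.+ b) ≡ 1ℤ ℤ.+ a - b
    cancel = solve-∀

  ρ-adjoin : (S : Family c) → ρ d (map (adjoin X) S) ≡ ρ e S
  ρ-adjoin S = cong sumℤ (trans (sym (map-∘ S)) (map-cong codim-adjoin S))

  D-adjoin : (S : Family c) → D d (map (adjoin X) S) ≡ D e S
  D-adjoin S = cong₂ _-_ (trans (cong (codim d) (sym (adjoin-⋂ X S))) (codim-adjoin (⋂ S))) (ρ-adjoin S)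

  inL-adjoin : (S : Family c) → T (inL d (map (adjoin X) S)) ⇔ T (inL e S)
  inL-adjoin S = mk⇔ down up
    where
    down : T (inL d (map (adjoin X) S)) → T (inL e S)
    down t = let small , indep = to (inL-⇔ d _) t in
      from (inL-⇔ e S) (
        All.map (λ {Y} le → subst (_≤ e) (ℕ.m+n∸m≡n ∣ X ∣ ∣ Y ∣)
                              (ℕ.∸-monoˡ-≤ ∣ X ∣ (subst (_≤ d) (∣adjoin∣ X Y) le))) (All.map⁻ small) ,
        All.map (λ {S′} pos 1< → subst (0ℤ ℤ.<_) (D-adjoin S′) (pos (subst (1 <_) (sym (length-map _ S′)) 1<)))
                 (All.map⁻ (subst (All _) (sublists-map (adjoin X) S) indep)))
    up : T (inL e S) → T (inL d (map (adjoin X) S))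
    up t = let small , indep = to (inL-⇔ e S) t in
      from (inL-⇔ d _) (
        All.map⁺ (All.map (λ {Y} le → subst₂ _≤_ (sym (∣adjoin∣ X Y)) (ℕ.m+[n∸m]≡n ∣X∣≤d)
                                                (ℕ.+-monoʳ-≤ ∣ X ∣ le)) small) ,
        subst (All _) (sym (sublists-map (adjoin X) S))
          (All.map⁺ (All.map (λ {S′} pos 1< → subst (0ℤ ℤ.<_) (sym (D-adjoin S′))
                                                     (pos (subst (1 <_) (length-map _ S′) 1<))) indep)))

  lt-adjoin : (S S′ : Family c) → T (lt d (map (adjoin X) S) (map (adjoin X) S′)) ⇔ T (lt e S S′)
  lt-adjoin S S′ = mk⇔
    (λ t → let ρ< , ref = to (lt-⇔ d _ _) t in
      from (lt-⇔ e S S′) (subst₂ ℤ._<_ (ρ-adjoin S) (ρ-adjoin S′) ρ< ,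
        All.map (covers⁻ _) (All.map⁻ ref)))
    (λ t → let ρ< , ref = to (lt-⇔ e S S′) t in
      from (lt-⇔ d _ _) (subst₂ ℤ._<_ (sym (ρ-adjoin S)) (sym (ρ-adjoin S′)) ρ< ,
        All.map⁺ (All.map (covers⁺ _) ref)))
    where
    covers⁻ : ∀ {Y} (R : Family c) → Any (_⊆ adjoin X Y) (map (adjoin X) R) → Any (_⊆ Y) R
    covers⁻ (_ ∷ _) (here Z⊆Y) = here (adjoin-cancel-⊆ X Z⊆Y)
    covers⁻ (_ ∷ R) (there R∋) = there (covers⁻ R R∋)
    covers⁺ : ∀ {Y} (R : Family c) → Any (_⊆ Y) R → Any (_⊆ adjoin X Y) (map (adjoin X) R)
    covers⁺ (_ ∷ _) (here Z⊆Y) = here (adjoin-mono-⊆ X Z⊆Y)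
    covers⁺ (_ ∷ R) (there R∋) = there (covers⁺ R R∋)

  -- Both recursions run on the same fuel, so induction on it compares them term by term, once the
  -- families with a member not containing `X` are discarded: none of these lies below a family of
  -- supersets of `X`.
  mobiusFuel-adjoin : (f : ℕ) (S : Family c) →
                      mobiusFuel n d f (map (adjoin X) S) ≡ mobiusFuel c e f S
  mobiusFuel-adjoin zero    S          = refl
  mobiusFuel-adjoin (suc f) []         = refl
  mobiusFuel-adjoin (suc f) S′@(_ ∷ _) = cong -_ (begin
    ∑ (filter (λ S → T? (lt d S (map (adjoin X) S′))) (L n d)) m
      ≡⟨ ∑-L-below d _ m ⟩
    ∑ (families n) w
      ≡⟨ ∑-sublists-filter (X ⊆?_) w (allSubsets n) w≡0 ⟩
    ∑ (sublists (filter (X ⊆?_) (allSubsets n))) w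
      ≡⟨ cong (λ xs → ∑ (sublists xs) w) (filter-⊇-allSubsets X) ⟩
    ∑ (sublists (map (adjoin X) (allSubsets c))) w
      ≡⟨ cong (λ xs → ∑ xs w) (sublists-map (adjoin X) (allSubsets c)) ⟩
    ∑ (map (map (adjoin X)) (families c)) w
      ≡⟨ ∑-map (map (adjoin X)) w (families c) ⟩
    ∑ (families c) (w ∘ map (adjoin X))
      ≡⟨ ∑-cong (families c) (λ S →
           when-cong (T? (inL d (map (adjoin X) S)) ×-dec T? (lt d (map (adjoin X) S) (map (adjoin X) S′)))
                     (T? (inL e S) ×-dec T? (lt e S S′))
                     (Product.map (to (inL-adjoin S)) (to (lt-adjoin S S′)))
                     (Product.map (from (inL-adjoin S)) (from (lt-adjoin S S′)))
                     (λ _ → mobiusFuel-adjoin f S)) ⟩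
    ∑ (families c) (λ S → when (T? (inL e S) ×-dec T? (lt e S S′)) (mobiusFuel c e f S))
      ≡⟨ sym (∑-L-below e S′ (mobiusFuel c e f)) ⟩
    ∑ (filter (λ S → T? (lt e S S′)) (L c e)) (mobiusFuel c e f) ∎)
    where
    open ≡-Reasoning
    m w : Family n → ℤ
    m = mobiusFuel n d f
    w S = when (T? (inL d S) ×-dec T? (lt d S (map (adjoin X) S′))) (m S)
    w≡0 : ∀ S → ¬ All (X ⊆_) S → w S ≡ 0ℤ
    w≡0 S ¬X⊆ = when-false (T? (inL d S) ×-dec T? (lt d S (map (adjoin X) S′))) λ (_ , S<) →
      ¬X⊆ (All.map (λ any {_} x∈ → let Y , _ , adjoin⊆ = find (Any.map⁻ any) in adjoin⊆ (⊆-adjoin X Y x∈))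
                   (proj₂ (to (lt-⇔ d _ _) S<)))

  μ-singleton : μ n d (X ∷ []) ≡ μ̂1 (n ∸ ∣ X ∣) e
  μ-singleton = begin
    μ n d (X ∷ [])
      ≡⟨ cong (λ Y → μ n d (Y ∷ [])) (sym (adjoin-⊥ X)) ⟩
    μ n d (map (adjoin X) (top c))
      ≡⟨ cong (λ r → mobiusFuel n d (suc (absℤ r)) (map (adjoin X) (top c))) (ρ-adjoin (top c)) ⟩
    mobiusFuel n d (suc (absℤ (ρ e (top c)))) (map (adjoin X) (top c))
      ≡⟨ mobiusFuel-adjoin (suc (absℤ (ρ e (top c)))) (top c) ⟩
    μ̂1 c e
      -- The smaller ground set was indexed by `∣ ∁ X ∣` because this computes along `X`, as the
      -- recursion in `adjoin` requires.
      ≡⟨ cong (λ m → μ̂1 m e) (∣∁p∣≡n∸∣p∣ X) ⟩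
    μ̂1 (n ∸ ∣ X ∣) e ∎
    where open ≡-Reasoning

-- Rank inequalities

module _ {A : Set} {P : Pred A 0ℓ} (P? : Decidable P) where

  filter-∁-[] : (xs : List A) → filter P? xs ≡ [] → filter (∁? P?) xs ≡ xs
  filter-∁-[] []       eq = refl
  filter-∁-[] (x ∷ xs) eq with P? x
  ... | no _ = cong (x ∷_) (filter-∁-[] xs eq)

  filter-[]-∁ : (xs : List A) → filter (∁? P?) xs ≡ [] → filter P? xs ≡ xs
  filter-[]-∁ []       eq = refl
  filter-[]-∁ (x ∷ xs) eq with P? x
  ... | yes _ = cong (x ∷_) (filter-[]-∁ xs eq)

  filter-↭ : (xs : List A) → xs ↭ filter P? xs ++ filter (∁? P?) xs
  filter-↭ []       = ↭-refl
  filter-↭ (x ∷ xs) with P? x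
  ... | yes _ = ↭-prep x (filter-↭ xs)
  ... | no _  = ↭-trans (↭-prep x (filter-↭ xs)) (↭-sym (shift x (filter P? xs) _))

  -- Stated for any commutative monoid because rank (sum), intersection and the product of Möbius
  -- values all have to split in the same way.
  fold-filter : {M : Set} {_∙_ : Op₂ M} {ε : M} → IsCommutativeMonoid _≡_ _∙_ ε →
                (h : List A → M) (f : A → M) → h [] ≡ ε → (∀ x xs → h (x ∷ xs) ≡ f x ∙ h xs) →
                ∀ xs → h xs ≡ h (filter P? xs) ∙ h (filter (∁? P?) xs)
  fold-filter {_∙_ = _∙_} {ε} cm h f h-[] h-∷ = go
    where
    open IsCommutativeMonoid cm using (assoc; comm; identityˡ)
    open ≡-Reasoning
    go : ∀ xs → h xs ≡ h (filter P? xs) ∙ h (filter (∁? P?) xs)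
    go [] = trans h-[] (sym (trans (cong₂ _∙_ h-[] h-[]) (identityˡ ε)))
    go (x ∷ xs) with P? x
    ... | yes _ = begin
      h (x ∷ xs)         ≡⟨ trans (h-∷ x xs) (cong (f x ∙_) (go xs)) ⟩
      f x ∙ (a ∙ b)      ≡⟨ sym (assoc (f x) a b) ⟩
      (f x ∙ a) ∙ b      ≡⟨ cong (_∙ b) (sym (h-∷ x _)) ⟩
      h (x ∷ filter P? xs) ∙ b ∎
      where a = h (filter P? xs); b = h (filter (∁? P?) xs)
    ... | no _ = begin
      h (x ∷ xs)         ≡⟨ trans (h-∷ x xs) (cong (f x ∙_) (go xs)) ⟩
      f x ∙ (a ∙ b)      ≡⟨ trans (sym (assoc (f x) a b)) (cong (_∙ b) (comm (f x) a)) ⟩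
      (a ∙ f x) ∙ b      ≡⟨ assoc a (f x) b ⟩
      a ∙ (f x ∙ b)      ≡⟨ cong (a ∙_) (sym (h-∷ x _)) ⟩
      a ∙ h (x ∷ filter (∁? P?) xs) ∎
      where a = h (filter P? xs); b = h (filter (∁? P?) xs)

module _ {P : Pred (Subset n) 0ℓ} (P? : Decidable P) where

  ρ-filter : (d : ℕ) (S : Family n) → ρ d S ≡ ρ d (filter P? S) ℤ.+ ρ d (filter (∁? P?) S)
  ρ-filter d = fold-filter P? ℤ.+-0-isCommutativeMonoid (ρ d) (codim d) refl (λ _ _ → refl)

  ⋂-filter : (S : Family n) → ⋂ S ≡ ⋂ (filter P? S) ∩ ⋂ (filter (∁? P?) S)
  ⋂-filter = fold-filter P? (∩-isCommutativeMonoid n) ⋂ id refl (λ _ _ → refl)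

⊆-⋂ : {X : Subset n} (S : Family n) → All (X ⊆_) S → X ⊆ ⋂ S
⊆-⋂ []      []        = ⊆⊤
⊆-⋂ (Y ∷ S) (X⊆Y ∷ X⊆) = λ x∈X → x∈p∩q⁺ (X⊆Y x∈X , ⊆-⋂ S X⊆ x∈X)

⊆⇒∣∣<⊎≡ : {X Y : Subset n} → X ⊆ Y → ∣ X ∣ < ∣ Y ∣ ⊎ X ≡ Y
⊆⇒∣∣<⊎≡ {X = []}          {[]}          X⊆Y = inj₂ refl
⊆⇒∣∣<⊎≡ {X = outside ∷ X} {inside ∷ Y}  X⊆Y = inj₁ (s≤s (p⊆q⇒∣p∣≤∣q∣ (drop-∷-⊆ X⊆Y)))
⊆⇒∣∣<⊎≡ {X = inside ∷ X}  {outside ∷ Y} X⊆Y with () ← X⊆Y Vec.here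
⊆⇒∣∣<⊎≡ {X = outside ∷ X} {outside ∷ Y} X⊆Y with ⊆⇒∣∣<⊎≡ (drop-∷-⊆ X⊆Y)
... | inj₁ lt   = inj₁ lt
... | inj₂ refl = inj₂ refl
⊆⇒∣∣<⊎≡ {X = inside ∷ X}  {inside ∷ Y}  X⊆Y with ⊆⇒∣∣<⊎≡ (drop-∷-⊆ X⊆Y)
... | inj₁ lt   = inj₁ (s≤s lt)
... | inj₂ refl = inj₂ refl

-- The part of `Y` outside `X` does not grow when it is intersected with `Z`. The additive form
-- avoids truncated subtraction.
∣∩∣-exchange : {X Y : Subset n} (Z : Subset n) → X ⊆ Y →
               ∣ Y ∩ Z ∣ + ∣ X ∣ ≤ ∣ X ∩ Z ∣ + ∣ Y ∣
∣∩∣-exchange {X = []}    {[]}    []      X⊆Y = z≤n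
∣∩∣-exchange {X = inside ∷ X} {outside ∷ Y} (_ ∷ Z) X⊆Y = contradiction (X⊆Y Vec.here) λ ()
∣∩∣-exchange {X = outside ∷ X} {outside ∷ Y} (_ ∷ Z) X⊆Y = ∣∩∣-exchange Z (drop-∷-⊆ X⊆Y)
∣∩∣-exchange {X = outside ∷ X} {inside ∷ Y} (outside ∷ Z) X⊆Y =
  ℕ.≤-trans (∣∩∣-exchange Z (drop-∷-⊆ X⊆Y)) (ℕ.+-monoʳ-≤ ∣ X ∩ Z ∣ (ℕ.n≤1+n ∣ Y ∣))
∣∩∣-exchange {X = outside ∷ X} {inside ∷ Y} (inside ∷ Z) X⊆Y =
  ℕ.≤-trans (s≤s (∣∩∣-exchange Z (drop-∷-⊆ X⊆Y))) (ℕ.≤-reflexive (sym (ℕ.+-suc ∣ X ∩ Z ∣ ∣ Y ∣)))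
∣∩∣-exchange {X = inside ∷ X} {inside ∷ Y} (outside ∷ Z) X⊆Y =
  subst₂ _≤_ (sym (ℕ.+-suc ∣ Y ∩ Z ∣ ∣ X ∣)) (sym (ℕ.+-suc ∣ X ∩ Z ∣ ∣ Y ∣)) (s≤s (∣∩∣-exchange Z (drop-∷-⊆ X⊆Y)))
∣∩∣-exchange {X = inside ∷ X} {inside ∷ Y} (inside ∷ Z) X⊆Y =
  s≤s (subst₂ _≤_ (sym (ℕ.+-suc ∣ Y ∩ Z ∣ ∣ X ∣)) (sym (ℕ.+-suc ∣ X ∩ Z ∣ ∣ Y ∣))
                  (s≤s (∣∩∣-exchange Z (drop-∷-⊆ X⊆Y))))

codim-pos : {d : ℕ} {X : Subset n} → ∣ X ∣ ≤ d → 0ℤ ℤ.< codim d X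
codim-pos {d = d} {X} ∣X∣≤d =
  subst (ℤ._< codim d X) (ℤ.+-inverseʳ (+ ∣ X ∣)) (ℤ.+-monoˡ-< (- + ∣ X ∣) (ℤ.+<+ (s≤s ∣X∣≤d)))

codim-anti-< : {d : ℕ} {X Y : Subset n} → ∣ X ∣ < ∣ Y ∣ → codim d Y ℤ.< codim d X
codim-anti-< {d = d} lt = ℤ.+-monoʳ-< (+ suc d) (ℤ.neg-mono-< (ℤ.+<+ lt))

codim-anti-⊆ : {d : ℕ} {X Y : Subset n} → X ⊆ Y → codim d Y ℤ.≤ codim d X
codim-anti-⊆ {d = d} X⊆Y = ℤ.+-monoʳ-≤ (+ suc d) (ℤ.neg-mono-≤ (ℤ.+≤+ (p⊆q⇒∣p∣≤∣q∣ X⊆Y)))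

-- Shrinking `Y` to `X` raises the codimension of the intersection with `Z` by at most the rise from
-- `codim d Y` to `codim d X`. This is the source of every comparison of `D` below.
codim-exchange : {d : ℕ} {X Y : Subset n} (Z : Subset n) → X ⊆ Y →
                 codim d (X ∩ Z) ℤ.+ codim d Y ℤ.≤ codim d (Y ∩ Z) ℤ.+ codim d X
codim-exchange {d = d} {X} {Y} Z X⊆Y = subst₂ ℤ._≤_
  (regroup (+ suc d) (+ ∣ X ∩ Z ∣) (+ ∣ Y ∣)) (regroup (+ suc d) (+ ∣ Y ∩ Z ∣) (+ ∣ X ∣))
  (ℤ.+-monoʳ-≤ (+ suc d ℤ.+ + suc d) (ℤ.neg-mono-≤ (ℤ.+≤+ (∣∩∣-exchange Z X⊆Y))))
  where
  regroup : ∀ s a b → s ℤ.+ s ℤ.+ - (a ℤ.+ b) ≡ s - a ℤ.+ (s - b)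
  regroup = solve-∀

inL-small : {d : ℕ} (S : Family n) → T (inL d S) → All (λ X → ∣ X ∣ ≤ d) S
inL-small {d = d} S S∈L = proj₁ (to (inL-⇔ d S) S∈L)

0<i-j⇒j<i : ∀ i j → 0ℤ ℤ.< i - j → j ℤ.< i
0<i-j⇒j<i i j 0< = subst₂ ℤ._<_ (ℤ.+-identityˡ j) (cancel i j) (ℤ.+-monoˡ-< j 0<)
  where
  cancel : ∀ i j → i - j ℤ.+ j ≡ i
  cancel = solve-∀

j<i⇒0<i-j : ∀ i j → j ℤ.< i → 0ℤ ℤ.< i - j
j<i⇒0<i-j i j j<i = subst (ℤ._< i - j) (ℤ.+-inverseʳ j) (ℤ.+-monoˡ-< (- j) j<i)

inL-ρ<codim-⋂ : {d : ℕ} (S : Family n) → T (inL d S) →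
                {S′ : Family n} → S′ ⊑ S → 1 < length S′ → ρ d S′ ℤ.< codim d (⋂ S′)
inL-ρ<codim-⋂ {d = d} S S∈L {S′} S′⊑S 1< =
  0<i-j⇒j<i (codim d (⋂ S′)) (ρ d S′) (All.lookup (proj₂ (to (inL-⇔ d S) S∈L)) (∈-sublists⁺ S′⊑S) 1<)

inL⁺ : {d : ℕ} (S : Family n) → All (λ X → ∣ X ∣ ≤ d) S →
       (∀ {S′} → S′ ⊑ S → 1 < length S′ → ρ d S′ ℤ.< codim d (⋂ S′)) → T (inL d S)
inL⁺ {d = d} S small indep = from (inL-⇔ d S) (small , All.tabulate λ {S′} S′∈ 1< →
  j<i⇒0<i-j (codim d (⋂ S′)) (ρ d S′) (indep (∈-sublists⁻ S S′∈) 1<))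

inL-⊑ : {d : ℕ} (S : Family n) {S′ : Family n} → S′ ⊑ S → T (inL d S) → T (inL d S′)
inL-⊑ {d = d} S S′⊑S S∈L =
  inL⁺ _ (All-resp-⊆ S′⊑S (inL-small S S∈L)) (λ R⊑S′ → inL-ρ<codim-⋂ S S∈L (⊑-trans R⊑S′ S′⊑S))

inL-ρ≥0 : {d : ℕ} (S : Family n) → T (inL d S) → 0ℤ ℤ.≤ ρ d S
inL-ρ≥0 S S∈L = go S (inL-small S S∈L)
  where
  go : ∀ {d} (S : Family _) → All (λ X → ∣ X ∣ ≤ d) S → 0ℤ ℤ.≤ ρ d S
  go []      []             = ℤ.≤-refl
  go {d} (X ∷ S) (small ∷ smalls) = ℤ.+-mono-≤ {0ℤ} {codim d X} (ℤ.<⇒≤ (codim-pos {X = X} small)) (go S smalls)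

-- A singleton has `D` equal to 0, which weakens the strict inequality. The empty family is excluded
-- because its intersection is `⊤`, whose codimension may be negative.
ρ≤codim-⋂ : {d : ℕ} (S : Family n) → T (inL d S) → S ≢ [] → ρ d S ℤ.≤ codim d (⋂ S)
ρ≤codim-⋂         []              _   S≢[] = contradiction refl S≢[]
ρ≤codim-⋂ {d = d} (X ∷ [])        _   _    =
  ℤ.≤-reflexive (trans (ℤ.+-identityʳ (codim d X)) (cong (codim d) (sym (∩-identityʳ X))))
ρ≤codim-⋂         S@(_ ∷ _ ∷ _)   S∈L _    = ℤ.<⇒≤ (inL-ρ<codim-⋂ S S∈L ⊑-refl (s≤s (s≤s z≤n)))

-- Adds the two inequalities and cancels `m`, the codimension of the intermediate stage at which all
-- but one block has been merged.
chain-≤ : ∀ a b m p q r y → a ℤ.+ p ℤ.≤ m ℤ.+ y → m ℤ.+ q ℤ.≤ b ℤ.+ r → a ℤ.+ (p ℤ.+ q) ℤ.≤ b ℤ.+ (y ℤ.+ r)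
chain-≤ a b m p q r y le₁ le₂ = begin
  a ℤ.+ (p ℤ.+ q)   ≡⟨ sym (ℤ.+-assoc a p q) ⟩
  a ℤ.+ p ℤ.+ q     ≤⟨ ℤ.+-monoˡ-≤ q le₁ ⟩
  m ℤ.+ y ℤ.+ q     ≡⟨ swap m y q ⟩
  m ℤ.+ q ℤ.+ y     ≤⟨ ℤ.+-monoˡ-≤ y le₂ ⟩
  b ℤ.+ r ℤ.+ y     ≡⟨ swap b r y ⟩
  b ℤ.+ y ℤ.+ r     ≡⟨ ℤ.+-assoc b y r ⟩
  b ℤ.+ (y ℤ.+ r)   ∎
  where
  open ℤ.≤-Reasoning
  swap : ∀ a b c → a ℤ.+ b ℤ.+ c ≡ a ℤ.+ c ℤ.+ b
  swap = solve-∀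

refines-∁ : {X : Subset n} {R : Family n} (S : Family n) → Refines S (X ∷ R) → Refines (filter (∁? (X ⊆?_)) S) R
refines-∁ {X = X} S ref = All.zipWith
  (λ { (X⊈ , here X⊆) → contradiction (λ {x} → X⊆ {x}) X⊈ ; (_ , there R∋) → R∋ })
  (All.all-filter (∁? (X ⊆?_)) S , All.filter⁺ (∁? (X ⊆?_)) ref)

cancel-< : ∀ {a b p r} → a ℤ.+ p ℤ.≤ b ℤ.+ r → r ℤ.< a → p ℤ.< b
cancel-< {a} {b} {p} {r} le r<a = ℤ.≰⇒> λ b≤p →
  ℤ.<⇒≱ (ℤ.+-mono-<-≤ r<a b≤p) (subst (a ℤ.+ p ℤ.≤_) (ℤ.+-comm b r) le)

-- Merging blocks, and closure of `L` under recombination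

module _ {d : ℕ} where

  -- Two moves: the block is first replaced by its intersection, whose codimension is at least the
  -- rank of the block, and this intersection is then shrunk to `X`.
  block-exchange : {X : Subset n} (S : Family n) (Z : Subset n) → T (inL d S) → S ≢ [] → All (X ⊆_) S →
                   codim d (X ∩ Z) ℤ.+ ρ d S ℤ.≤ codim d (⋂ S ∩ Z) ℤ.+ codim d X
  block-exchange {X = X} S Z S∈L S≢[] X⊆ =
    ℤ.≤-trans (ℤ.+-monoʳ-≤ (codim d (X ∩ Z)) (ρ≤codim-⋂ S S∈L S≢[])) (codim-exchange Z (⊆-⋂ S X⊆))

  -- Merging the members of S block by block into the members of R below them cannot increase D.
  coarsen : (R S : Family n) (Z : Subset n) → T (inL d S) → Refines S R →
            ∃[ R′ ] R′ ⊑ R × (R′ ≡ [] → S ≡ []) ×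
                    codim d (Z ∩ ⋂ R′) ℤ.+ ρ d S ℤ.≤ codim d (Z ∩ ⋂ S) ℤ.+ ρ d R′
  coarsen []      []      Z _   _        = [] , [] , (λ _ → refl) , ℤ.≤-refl
  coarsen []      (_ ∷ _) Z _   (() ∷ _)
  coarsen (Y ∷ R) S       Z S∈L ref = split (filter (Y ⊆?_) S) refl
    where
    S₁ = filter (Y ⊆?_) S
    S₂ = filter (∁? (Y ⊆?_)) S
    S₂∈L = inL-⊑ S (filter-⊆ (∁? (Y ⊆?_)) S) S∈L
    split : ∀ S′ → S₁ ≡ S′ →
            ∃[ R′ ] R′ ⊑ Y ∷ R × (R′ ≡ [] → S ≡ []) ×
                    codim d (Z ∩ ⋂ R′) ℤ.+ ρ d S ℤ.≤ codim d (Z ∩ ⋂ S) ℤ.+ ρ d R′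
    -- A member of `R` with an empty block is left out of `R′`, since `block-exchange` requires a
    -- nonempty block.
    split [] eq with coarsen R S₂ Z S₂∈L (refines-∁ S ref)
    ... | R′ , R′⊑R , R′≡[] , le rewrite filter-∁-[] (Y ⊆?_) S eq = R′ , Y ∷ʳ R′⊑R , R′≡[] , le
    -- The block over `Y` joins the context `Z`, so the remaining members are merged inside the full
    -- intersection before this block is replaced.
    split S′@(_ ∷ _) eq with coarsen R S₂ (⋂ S₁ ∩ Z) S₂∈L (refines-∁ S ref)
    ... | R′ , R′⊑R , _ , le = Y ∷ R′ , refl ∷ R′⊑R , (λ ()) ,
      subst₂ ℤ._≤_ (cong₂ (λ A r → codim d A ℤ.+ r) eq₁ (sym (ρ-filter (Y ⊆?_) d S)))
                   (cong (λ A → codim d A ℤ.+ ρ d (Y ∷ R′)) eq₂)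
        (chain-≤ (codim d (Y ∩ (Z ∩ ⋂ R′))) (codim d ((⋂ S₁ ∩ Z) ∩ ⋂ S₂)) (codim d (⋂ S₁ ∩ (Z ∩ ⋂ R′)))
                 (ρ d S₁) (ρ d S₂) (ρ d R′) (codim d Y)
          (block-exchange S₁ (Z ∩ ⋂ R′) (inL-⊑ S (filter-⊆ (Y ⊆?_) S) S∈L)
            (λ S₁≡[] → case trans (sym eq) S₁≡[] of λ ()) (All.all-filter (Y ⊆?_) S))
          (subst (λ A → codim d A ℤ.+ ρ d S₂ ℤ.≤ codim d ((⋂ S₁ ∩ Z) ∩ ⋂ S₂) ℤ.+ ρ d R′)
                 (∩-assoc (⋂ S₁) Z (⋂ R′)) le))
      where
      open ≡-Reasoning
      eq₁ : Y ∩ (Z ∩ ⋂ R′) ≡ Z ∩ (Y ∩ ⋂ R′)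
      eq₁ = trans (sym (∩-assoc Y Z _)) (trans (cong (_∩ ⋂ R′) (∩-comm Y Z)) (∩-assoc Z Y _))
      eq₂ : (⋂ S₁ ∩ Z) ∩ ⋂ S₂ ≡ Z ∩ ⋂ S
      eq₂ = begin
        (⋂ S₁ ∩ Z) ∩ ⋂ S₂   ≡⟨ cong (_∩ ⋂ S₂) (∩-comm (⋂ S₁) Z) ⟩
        (Z ∩ ⋂ S₁) ∩ ⋂ S₂   ≡⟨ ∩-assoc Z _ _ ⟩
        Z ∩ (⋂ S₁ ∩ ⋂ S₂)   ≡⟨ cong (Z ∩_) (sym (⋂-filter (Y ⊆?_) S)) ⟩
        Z ∩ ⋂ S             ∎

  -- Only a subfamily meeting both sides needs an argument. Merging turns it into `X ∷ R′` with `R′`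
  -- a subfamily of `R`, and the positive `D` of that family bounds the original one from below.
  inL-union : {X : Subset n} {R : Family n} (S : Family n) → T (inL d (X ∷ R)) →
              T (inL d (filter (X ⊆?_) S)) → T (inL d (filter (∁? (X ⊆?_)) S)) →
              Refines (filter (∁? (X ⊆?_)) S) R → T (inL d S)
  inL-union {n = n} {X} {R} S XR∈L S₁∈L S₂∈L ref =
    inL⁺ S (All.filter⁻ (X ⊆?_) (inL-small _ S₁∈L) (inL-small _ S₂∈L)) indep
    where
    indep : ∀ {A} → A ⊑ S → 1 < length A → ρ d A ℤ.< codim d (⋂ A)
    indep {A} A⊑S 1< = split (filter (X ⊆?_) A) refl (filter (∁? (X ⊆?_)) A) refl
      where
      A₁ = filter (X ⊆?_) A
      A₂ = filter (∁? (X ⊆?_)) A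
      A₁⊑S₁ : A₁ ⊑ filter (X ⊆?_) S
      A₁⊑S₁ = filter⁺ (X ⊆?_) (X ⊆?_) (λ { refl → id }) A⊑S
      A₂⊑S₂ : A₂ ⊑ filter (∁? (X ⊆?_)) S
      A₂⊑S₂ = filter⁺ (∁? (X ⊆?_)) (∁? (X ⊆?_)) (λ { refl → id }) A⊑S
      split : ∀ B₁ → A₁ ≡ B₁ → ∀ B₂ → A₂ ≡ B₂ → ρ d A ℤ.< codim d (⋂ A)
      split [] eq₁ _ _ = inL-ρ<codim-⋂ _ S₂∈L (subst (_⊑ _) (filter-∁-[] (X ⊆?_) A eq₁) A₂⊑S₂) 1<
      split (_ ∷ _) eq₁ [] eq₂ = inL-ρ<codim-⋂ _ S₁∈L (subst (_⊑ _) (filter-[]-∁ (X ⊆?_) A eq₂) A₁⊑S₁) 1<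
      split (_ ∷ _) eq₁ (_ ∷ _) eq₂
        with coarsen R A₂ (⋂ A₁) (inL-⊑ _ A₂⊑S₂ S₂∈L) (All-resp-⊆ A₂⊑S₂ ref)
      -- `R′` cannot be empty because `A₂` is not; hence `X ∷ R′` has the two members needed for
      -- strict positivity.
      ... | [] , _ , R′≡[]⇒ , _ with () ← trans (sym eq₂) (R′≡[]⇒ refl)
      ... | R′@(_ ∷ _) , R′⊑R , _ , le = cancel-<
        (subst₂ (λ r B → codim d (X ∩ ⋂ R′) ℤ.+ r ℤ.≤ codim d B ℤ.+ ρ d (X ∷ R′))
          (sym (ρ-filter (X ⊆?_) d A)) (sym (⋂-filter (X ⊆?_) A))
          (chain-≤ (codim d (X ∩ ⋂ R′)) (codim d (⋂ A₁ ∩ ⋂ A₂)) (codim d (⋂ A₁ ∩ ⋂ R′))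
                   (ρ d A₁) (ρ d A₂) (ρ d R′) (codim d X)
            (block-exchange A₁ (⋂ R′) (inL-⊑ _ A₁⊑S₁ S₁∈L)
              (λ A₁≡[] → case trans (sym eq₁) A₁≡[] of λ ()) (All.all-filter (X ⊆?_) A))
            le))
        (inL-ρ<codim-⋂ _ XR∈L (refl ∷ R′⊑R) (s≤s (s≤s z≤n)))

  -- Supplies the strictness in `refines-rank`. Two or more members lose rank by independence, a
  -- single one by being larger than `X`, and none because `codim d X` is positive.
  block-rank : {X : Subset n} (S : Family n) → ∣ X ∣ ≤ d → T (inL d S) → All (X ⊆_) S →
               ρ d S ℤ.< codim d X ⊎ S ≡ X ∷ []
  block-rank {X = X} []       ∣X∣≤d _ _ = inj₁ (codim-pos {X = X} ∣X∣≤d)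
  block-rank {X = X} (Y ∷ []) _ _ (X⊆Y ∷ []) with ⊆⇒∣∣<⊎≡ X⊆Y
  ... | inj₁ lt   = inj₁ (subst (ℤ._< codim d X) (sym (ℤ.+-identityʳ (codim d Y))) (codim-anti-< {X = X} {Y} lt))
  ... | inj₂ refl = inj₂ refl
  block-rank S@(_ ∷ _ ∷ _) _ S∈L X⊆ =
    inj₁ (ℤ.<-≤-trans (inL-ρ<codim-⋂ S S∈L ⊑-refl (s≤s (s≤s z≤n))) (codim-anti-⊆ (⊆-⋂ S X⊆)))

  -- On L the rank condition in lt only rules out equality.
  refines-rank : (R S : Family n) → All (λ X → ∣ X ∣ ≤ d) R → T (inL d S) → Refines S R →
                 ρ d S ℤ.< ρ d R ⊎ (ρ d S ≡ ρ d R × S ↭ R)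
  refines-rank []      []      _                _   _   = inj₂ (refl , ↭-refl)
  refines-rank []      (_ ∷ _) _                _   (() ∷ _)
  refines-rank (X ∷ R) S       (small ∷ smalls) S∈L ref
    with block-rank (filter (X ⊆?_) S) small (inL-⊑ S (filter-⊆ (X ⊆?_) S) S∈L) (All.all-filter (X ⊆?_) S)
       | refines-rank R (filter (∁? (X ⊆?_)) S) smalls (inL-⊑ S (filter-⊆ (∁? (X ⊆?_)) S) S∈L) (refines-∁ S ref)
  ... | inj₁ lt | inj₁ lt′ = inj₁ (subst (ℤ._< ρ d (X ∷ R)) (sym (ρ-filter (X ⊆?_) d S))
    (ℤ.+-mono-< lt lt′))
  ... | inj₁ lt | inj₂ (eq , _) = inj₁ (subst (ℤ._< ρ d (X ∷ R)) (sym (ρ-filter (X ⊆?_) d S))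
    (ℤ.+-mono-<-≤ lt (ℤ.≤-reflexive eq)))
  ... | inj₂ eq | inj₁ lt′ = inj₁ (subst (ℤ._< ρ d (X ∷ R)) (sym (ρ-filter (X ⊆?_) d S))
    (ℤ.+-mono-≤-< (ℤ.≤-reflexive (trans (cong (ρ d) eq) (ℤ.+-identityʳ (codim d X)))) lt′))
  ... | inj₂ eq | inj₂ (eq′ , S₂↭R) = inj₂
    ( trans (ρ-filter (X ⊆?_) d S) (cong₂ ℤ._+_ (trans (cong (ρ d) eq) (ℤ.+-identityʳ (codim d X))) eq′)
    , ↭-trans (filter-↭ (X ⊆?_) S) (subst (λ B → B ++ filter (∁? (X ⊆?_)) S ↭ X ∷ R) (sym eq) (↭-prep X S₂↭R)) )

-- Multiplicativity of μ

allSubsets-unique : (n : ℕ) → Unique (allSubsets n)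
allSubsets-unique zero    = [] ∷ []
allSubsets-unique (suc n) =
  Unique.++⁺ (Unique.map⁺ (λ { refl → refl }) (allSubsets-unique n))
             (Unique.map⁺ (λ { refl → refl }) (allSubsets-unique n))
             disjoint
  where
  disjoint : ∀ {X} → ¬ (X ∈ map (outside ∷_) (allSubsets n) × X ∈ map (inside ∷_) (allSubsets n))
  disjoint (X∈ , X∈′) with ∈-map⁻ (outside ∷_) X∈ | ∈-map⁻ (inside ∷_) X∈′
  ... | _ , _ , refl | _ , _ , ()

∣∣-mono-< : ∀ {i j} → 0ℤ ℤ.≤ i → i ℤ.< j → absℤ i < absℤ j
∣∣-mono-< (ℤ.+≤+ _) (ℤ.+<+ lt) = lt

Refines-refl : (S : Family n) → Refines S S
Refines-refl []      = []
Refines-refl (X ∷ S) = here ⊆-refl ∷ All.map there (Refines-refl S)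

Refines-[X]⁺ : {X : Subset n} {S : Family n} → All (X ⊆_) S → Refines S (X ∷ [])
Refines-[X]⁺ []        = []
Refines-[X]⁺ (X⊆ ∷ X⊆s) = here X⊆ ∷ Refines-[X]⁺ X⊆s

Refines-[X]⁻ : {X : Subset n} {S : Family n} → Refines S (X ∷ []) → All (X ⊆_) S
Refines-[X]⁻ []              = []
Refines-[X]⁻ (here X⊆ ∷ ref) = X⊆ ∷ Refines-[X]⁻ ref

Refines-∷ : {X : Subset n} {S R : Family n} → Refines S (X ∷ []) → Refines S (X ∷ R)
Refines-∷ []              = []
Refines-∷ (here X⊆ ∷ ref) = here X⊆ ∷ Refines-∷ ref

refines? : (S S′ : Family n) → Dec (Refines S S′)
refines? S S′ = All.all? (λ X → Any.any? (_⊆? X) S′) S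

module _ (d : ℕ) where

  below? : (S S′ : Family n) → Dec (T (inL d S) × T (lt d S S′))
  below? S S′ = T? (inL d S) ×-dec T? (lt d S S′)

  upTo? : (S S′ : Family n) → Dec (T (inL d S) × Refines S S′)
  upTo? S S′ = T? (inL d S) ×-dec refines? S S′

  below⇒∣ρ∣< : (S S′ : Family n) → T (inL d S) × T (lt d S S′) → absℤ (ρ d S) < absℤ (ρ d S′)
  below⇒∣ρ∣< S S′ (S∈L , S<) = ∣∣-mono-< (inL-ρ≥0 S S∈L) (proj₁ (to (lt-⇔ d S S′) S<))

  -- Each recursive call moves to a family in `L` of smaller rank, and ranks on `L` are nonnegative,
  -- so fuel exceeding the rank is never exhausted.
  mobiusFuel-irrelevant : (f g : ℕ) (S : Family n) → absℤ (ρ d S) < f → absℤ (ρ d S) < g →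
                          mobiusFuel n d f S ≡ mobiusFuel n d g S
  mobiusFuel-irrelevant (suc f) (suc g) []         _        _        = refl
  mobiusFuel-irrelevant {n} (suc f) (suc g) S@(_ ∷ _) (s≤s <f) (s≤s <g) = cong -_ (begin
    ∑ (filter (λ R → T? (lt d R S)) (L n d)) (mobiusFuel n d f)
      ≡⟨ ∑-L-below d S (mobiusFuel n d f) ⟩
    ∑ (families n) (λ R → when (below? R S) (mobiusFuel n d f R))
      ≡⟨ ∑-cong (families n) (λ R → when-cong (below? R S) (below? R S) id id λ R< →
           mobiusFuel-irrelevant f g R (ℕ.<-≤-trans (below⇒∣ρ∣< R S R<) <f) (ℕ.<-≤-trans (below⇒∣ρ∣< R S R<) <g)) ⟩
    ∑ (families n) (λ R → when (below? R S) (mobiusFuel n d g R))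
      ≡⟨ sym (∑-L-below d S (mobiusFuel n d g)) ⟩
    ∑ (filter (λ R → T? (lt d R S)) (L n d)) (mobiusFuel n d g) ∎)
    where open ≡-Reasoning

  μ-recursion : (S : Family n) → S ≢ [] → μ n d S ≡ - ∑ (families n) (λ R → when (below? R S) (μ n d R))
  μ-recursion     []         S≢[] = contradiction refl S≢[]
  μ-recursion {n} S@(_ ∷ _) _    = cong -_ (trans (∑-L-below d S _) (∑-cong (families n) λ R →
    when-cong (below? R S) (below? R S) id id λ R< → mobiusFuel-irrelevant _ _ R (below⇒∣ρ∣< R S R<) ℕ.≤-refl))

  -- The F of the overview. Its factors are values in the same poset; they become values at maxima
  -- of smaller lattices only at the end, through `μ-singleton`.
  ∏μ : Family n → ℤ
  ∏μ {n} S = prodℤ (map (λ X → μ n d (X ∷ [])) S)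

  -- `∑upTo` uses refinement without the rank inequality, because refinement can be tested
  -- separately on the two parts of a family.
  ∑below ∑upTo : Family n → ℤ
  ∑below {n} S = ∑ (families n) (λ R → when (below? R S) (∏μ R))
  ∑upTo  {n} S = ∑ (families n) (λ R → when (upTo? R S) (∏μ R))

  -- By `refines-rank`, a refinement in `L` has smaller rank or is a permutation of `S`; among
  -- canonical lists the latter is `S` itself.
  ∑upTo-∑below : (S : Family n) → S ⊑ allSubsets n → T (inL d S) → ∑upTo S ≡ ∑below S ℤ.+ ∏μ S
  ∑upTo-∑below {n} S S⊑ S∈L = trans
    (∑-except (sublists-unique (allSubsets-unique n)) (∈-sublists⁺ S⊑) off-diagonal
      (when-false (below? S S) λ (_ , S<S) → ℤ.<-irrefl refl (proj₁ (to (lt-⇔ d S S) S<S))))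
    (cong (ℤ._+_ (∑below S)) (when-true (upTo? S S) (S∈L , Refines-refl S)))
    where
    off-diagonal : ∀ R → R ∈ families n → R ≢ S → when (upTo? R S) (∏μ R) ≡ when (below? R S) (∏μ R)
    off-diagonal R R∈ R≢S = when-cong (upTo? R S) (below? R S) strict
      (λ (R∈L , R<S) → R∈L , proj₂ (to (lt-⇔ d R S) R<S)) (λ _ → refl)
      where
      strict : T (inL d R) × Refines R S → T (inL d R) × T (lt d R S)
      strict (R∈L , ref) with refines-rank S R (inL-small S S∈L) R∈L ref
      ... | inj₁ ρ<        = R∈L , from (lt-⇔ d R S) (ρ< , ref)
      ... | inj₂ (_ , R↭S) = contradiction (⊑-↭⇒≡ (allSubsets-unique n) (∈-sublists⁻ _ R∈) S⊑ R↭S) R≢S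

  ∑upTo-∷ : (X : Subset n) (R : Family n) → T (inL d (X ∷ R)) → ∑upTo (X ∷ []) ≡ 0ℤ → ∑upTo (X ∷ R) ≡ 0ℤ
  ∑upTo-∷ {n} X R XR∈L upTo≡0 = begin
    ∑upTo (X ∷ R)
      ≡⟨ ∑-cong (families n) factor ⟩
    ∑ (families n) (λ S → f (filter X? S) * g (filter (∁? X?) S))
      ≡⟨ ∑-sublists-* X? f g (allSubsets n) ⟩
    ∑ (sublists (filter X? (allSubsets n))) f * ∑ (sublists (filter (∁? X?) (allSubsets n))) g
      -- `f` vanishes on families with a member not containing `X`, so the restricted sum is all of
      -- `∑upTo (X ∷ [])`.
      ≡⟨ cong (_* ∑ (sublists (filter (∁? X?) (allSubsets n))) g)
              (trans (sym (∑-sublists-filter X? f (allSubsets n) f≡0)) upTo≡0) ⟩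
    0ℤ ∎
    where
    open ≡-Reasoning
    X? : Decidable (X ⊆_)
    X? = X ⊆?_
    f g : Family n → ℤ
    f S = when (upTo? S (X ∷ [])) (∏μ S)
    g S = when (upTo? S R) (∏μ S)
    f≡0 : ∀ S → ¬ All (X ⊆_) S → f S ≡ 0ℤ
    f≡0 S ¬X⊆ = when-false (upTo? S (X ∷ [])) (¬X⊆ ∘ Refines-[X]⁻ ∘ proj₂)
    split : ∀ S → T (inL d S) × Refines S (X ∷ R) →
            (T (inL d (filter X? S)) × Refines (filter X? S) (X ∷ [])) ×
            (T (inL d (filter (∁? X?) S)) × Refines (filter (∁? X?) S) R)
    split S (S∈L , ref) =
      (inL-⊑ S (filter-⊆ X? S) S∈L , Refines-[X]⁺ (All.all-filter X? S)) ,
      (inL-⊑ S (filter-⊆ (∁? X?) S) S∈L , refines-∁ S ref)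
    merge : ∀ S → (T (inL d (filter X? S)) × Refines (filter X? S) (X ∷ [])) ×
                  (T (inL d (filter (∁? X?) S)) × Refines (filter (∁? X?) S) R) →
            T (inL d S) × Refines S (X ∷ R)
    merge S ((S₁∈L , ref₁) , (S₂∈L , ref₂)) =
      inL-union S XR∈L S₁∈L S₂∈L ref₂ ,
      All.filter⁻ X? (Refines-∷ ref₁) (All.map there ref₂)
    factor : ∀ S → when (upTo? S (X ∷ R)) (∏μ S) ≡ f (filter X? S) * g (filter (∁? X?) S)
    factor S = trans
      (when-cong (upTo? S (X ∷ R)) (upTo? (filter X? S) (X ∷ []) ×-dec upTo? (filter (∁? X?) S) R)
        (split S) (merge S)
        (λ _ → fold-filter X? ℤ.*-1-isCommutativeMonoid ∏μ (λ Y → μ n d (Y ∷ [])) refl (λ _ _ → refl) S))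
      (sym (when-*-when (upTo? (filter X? S) (X ∷ [])) (upTo? (filter (∁? X?) S) R) _ _))

  -- The induction is on a bound for the rank, since the hypothesis is needed at all families below
  -- `S` and below `X ∷ []`, not just at sublists.
  μ≡∏μ : (S : Family n) → S ⊑ allSubsets n → T (inL d S) → μ n d S ≡ ∏μ S
  μ≡∏μ {n} S S⊑ S∈L = go (suc (absℤ (ρ d S))) S ℕ.≤-refl S⊑ S∈L
    where
    go : (b : ℕ) (S : Family n) → absℤ (ρ d S) < b → S ⊑ allSubsets n → T (inL d S) → μ n d S ≡ ∏μ S
    go (suc b) []           _        _  _   = refl
    go (suc b) (X ∷ [])     _        _  _   = sym (ℤ.*-identityʳ _)
    go (suc b) S@(X ∷ R@(Y ∷ R′)) (s≤s ∣ρ∣≤b) S⊑ S∈L = begin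
      μ n d S        ≡⟨ μ-below S (λ ()) ∣ρ∣≤b ⟩
      - ∑below S     ≡⟨ negate {∑below S} {∏μ S} (trans (sym (∑upTo-∑below S S⊑ S∈L))
                                                    (∑upTo-∷ X R S∈L ∑upTo-X≡0)) ⟩
      ∏μ S           ∎
      where
      open ≡-Reasoning
      negate : ∀ {i j} → i ℤ.+ j ≡ 0ℤ → - i ≡ j
      negate {i} {j} eq = trans (sym (ℤ.+-identityʳ (- i))) (trans (cong (ℤ._+_ (- i)) (sym eq)) (cancel i j))
        where
        cancel : ∀ i j → - i ℤ.+ (i ℤ.+ j) ≡ j
        cancel = solve-∀
      -- Serves both `S` and `X ∷ []`: strictly below either one, the induction hypothesis replaces
      -- `μ` by `∏μ` in the recursion.
      μ-below : (U : Family n) → U ≢ [] → absℤ (ρ d U) ≤ b → μ n d U ≡ - ∑below U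
      μ-below U U≢[] ≤b = trans (μ-recursion U U≢[]) (cong -_ (∑-cong-∈ (families n) λ A A∈ →
        when-cong (below? A U) (below? A U) id id λ A< →
          go b A (ℕ.<-≤-trans (below⇒∣ρ∣< A U A<) ≤b) (∈-sublists⁻ _ A∈) (proj₁ A<)))
      X⊑S : X ∷ [] ⊑ S
      X⊑S = refl ∷ minimum R
      X∈L : T (inL d (X ∷ []))
      X∈L = inL-⊑ S X⊑S S∈L
      -- The second member `Y` contributes a positive codimension, which keeps `X ∷ []` within the
      -- same bound.
      ρX<ρS : ρ d (X ∷ []) ℤ.< ρ d S
      ρX<ρS with inL-small S S∈L
      ... | _ ∷ small ∷ _ = ℤ.+-monoʳ-< (codim d X)
        (ℤ.+-mono-<-≤ {0ℤ} {codim d Y} (codim-pos {X = Y} small) (inL-ρ≥0 R′ (inL-⊑ S (X ∷ʳ (Y ∷ʳ ⊑-refl)) S∈L)))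
      ∑upTo-X≡0 : ∑upTo (X ∷ []) ≡ 0ℤ
      ∑upTo-X≡0 = begin
        ∑upTo (X ∷ [])
          ≡⟨ ∑upTo-∑below (X ∷ []) (⊑-trans X⊑S S⊑) X∈L ⟩
        ∑below (X ∷ []) ℤ.+ ∏μ (X ∷ [])
          ≡⟨ cong (ℤ._+_ (∑below (X ∷ []))) (ℤ.*-identityʳ _) ⟩
        ∑below (X ∷ []) ℤ.+ μ n d (X ∷ [])
          ≡⟨ cong (ℤ._+_ (∑below (X ∷ []))) (μ-below (X ∷ []) (λ ())
               (ℕ.≤-trans (ℕ.<⇒≤ (∣∣-mono-< (inL-ρ≥0 (X ∷ []) X∈L) ρX<ρS)) ∣ρ∣≤b)) ⟩
        ∑below (X ∷ []) - ∑below (X ∷ [])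
          ≡⟨ ℤ.+-inverseʳ (∑below (X ∷ [])) ⟩
        0ℤ ∎

-- The codimension is positive here, so `absℤ` merely converts it to a natural number and the later
-- `∸ 1` truncates nothing.
∣codim∣ : (d : ℕ) (X : Subset n) → ∣ X ∣ ≤ d → absℤ (codim d X) ≡ suc (d ∸ ∣ X ∣)
∣codim∣ d X ∣X∣≤d =
  trans (cong absℤ (trans (ℤ.m-n≡m⊖n (suc d) ∣ X ∣) (ℤ.⊖-≥ (ℕ.m≤n⇒m≤1+n ∣X∣≤d))))
        (ℕ.+-∸-assoc 1 ∣X∣≤d)

theorem13 : (d k : ℕ) → 1 ≤ d →
    (T : Family (d + k + 1)) → T ∈ L (d + k + 1) d → T ≢ [] →
    (μ (d + k + 1) d T
    ≡ prodℤ (map (λ Ti → μ̂1 ((d + k + 1) ∸ ∣ Ti ∣) (d ∸ ∣ Ti ∣)) T))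
    × (prodℤ (map (λ Ti → μ̂1 ((d + k + 1) ∸ ∣ Ti ∣) (d ∸ ∣ Ti ∣)) T)
    ≡ prodℤ (map (λ Ti → μ̂1 (k + absℤ (codim d Ti)) (absℤ (codim d Ti) ∸ 1)) T))
theorem13 d k _ S S∈ _ with ∈-filter⁻ (λ S → T? (inL d S)) {xs = families (d + k + 1)} S∈
... | S∈families , S∈L =
  trans (μ≡∏μ d S (∈-sublists⁻ _ S∈families) S∈L)
        (cong prodℤ (map-cong-local (All.map (λ {X} → μ-singleton d X) small))) ,
  cong prodℤ (map-cong-local (All.map (λ {X} ∣X∣≤d →
    cong₂ μ̂1 (complement-size X ∣X∣≤d) (cong (_∸ 1) (sym (∣codim∣ d X ∣X∣≤d)))) small))
  where
  small = inL-small S S∈L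
  complement-size : ∀ X → ∣ X ∣ ≤ d → (d + k + 1) ∸ ∣ X ∣ ≡ k + absℤ (codim d X)
  complement-size X ∣X∣≤d = begin
    d + k + 1 ∸ ∣ X ∣         ≡⟨ cong (_∸ ∣ X ∣) (trans (ℕ.+-comm (d + k) 1) (cong suc (ℕ.+-comm d k))) ⟩
    suc (k + d) ∸ ∣ X ∣       ≡⟨ cong (_∸ ∣ X ∣) (sym (ℕ.+-suc k d)) ⟩
    k + suc d ∸ ∣ X ∣         ≡⟨ ℕ.+-∸-assoc k (ℕ.m≤n⇒m≤1+n ∣X∣≤d) ⟩
    k + (suc d ∸ ∣ X ∣)       ≡⟨ cong (k ℕ.+_) (trans (ℕ.+-∸-assoc 1 ∣X∣≤d) (sym (∣codim∣ d X ∣X∣≤d))) ⟩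
    k + absℤ (codim d X)      ∎
    where open ≡-Reasoning
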